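{- Let $H$ be a connected graph of order $a \in \mathbb{N}$. Then for every integer $b \ge 2$, $R_\mathrm{cyc}(H, C_b^\mathrm{mon}) \ge 1 + (a-1)(b-1)$.
   Context: All graphs are finite, simple and undirected, and a graph of order $n$ has vertex set $\{0,1,\ldots,n-1\}$; $K_n$ is the complete graph on $\{0,\ldots,n-1\}$. A $2$-edge-coloring of $K_n$ assigns each edge a color in $\{1,2\}$. For a graph $H$ and such a coloring, an embedding of $H$ in color $j$ is an injective map $\varphi\colon V(H)\to V(K_n)$ such that for every edge $uv$ of $H$ the edge $\{\varphi(u),\varphi(v)\}$ has color $j$; it is increasing up to a cyclic permutation if there exists $t\in V(H)$ such that $(\varphi(t),\ldots,\varphi(|H|-1),\varphi(0),\ldots,\varphi(t-1))$ is increasing. The cyclic Ramsey number $R_\mathrm{cyc}(H_1,H_2)$ is the smallest $n$ such that every $2$-edge-coloring of $K_n$ admits an embedding of $H_1$ in color $1$ or of $H_2$ in color $2$ that is increasing up to a cyclic permutation. For $n\ge 3$, the monotone cycle $C_n^\mathrm{mon}$ is the graph of order $n$ with edges $\{i,i+1\}$ for $0\le i\le n-2$ together with $\{0,n-1\}$; by convention $C_2^\mathrm{mon}=K_2$. -}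

module Defs where

open import Level using (0ℓ)
open import Data.Nat.Base using (ℕ; suc; _≤_; s≤s)
open import Data.Nat.Properties using (1+n≢n)
import Data.Nat.Properties as ℕ
open import Data.Fin.Base using (Fin; toℕ; _<_)
open import Data.List.Base using (List; tabulate; drop; take; _++_)
open import Data.List.Relation.Unary.Linked using (Linked)
open import Data.Product.Base using (∃; ∃-syntax; _×_; _,_)
open import Data.Sum.Base using (_⊎_; inj₁; inj₂; swap)
open import Function.Definitions using (Injective)
open import Relation.Binary.Core using (Rel)
open import Relation.Binary.Definitions using (Decidable; Symmetric)
open import Relation.Binary.Construct.Closure.ReflexiveTransitive using (Star)
open import Relation.Binary.PropositionalEquality.Core using (_≡_; refl; sym; trans)
open import Relation.Nullary.Negation.Core using (¬_)
open import Relation.Nullary.Decidable using (_×-dec_; _⊎-dec_)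

record Graph (n : ℕ) : Set₁ where
  field
    Adj    : Rel (Fin n) 0ℓ
    adj?   : Decidable Adj
    symm   : Symmetric Adj
    irrefl : ∀ v → ¬ Adj v v

open Graph public using (Adj)

Connected : ∀ {n} → Graph n → Set
Connected G = ∀ u v → Star (Adj G) u v

-- For n = 2 the two kinds of edge coincide, so the graph is K₂.
CmonEdge : ∀ n → Rel (Fin n) 0ℓ
CmonEdge n i j = (suc (toℕ i) ≡ toℕ j) ⊎ (toℕ i ≡ 0 × suc (toℕ j) ≡ n)

Cmon : ∀ n → 2 ≤ n → Graph n
Cmon n 2≤n = record
  { Adj    = λ i j → CmonEdge n i j ⊎ CmonEdge n j i
  ; adj?   = λ i j → edge? i j ⊎-dec edge? j i
  ; symm   = swap
  ; irrefl = λ { v (inj₁ e) → noLoop 2≤n v e ; v (inj₂ e) → noLoop 2≤n v e }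
  }
  where
  edge? : Decidable (CmonEdge n)
  edge? i j = (suc (toℕ i) ℕ.≟ toℕ j) ⊎-dec ((toℕ i ℕ.≟ 0) ×-dec (suc (toℕ j) ℕ.≟ n))

  noLoop : ∀ {m} → 2 ≤ m → ∀ v → ¬ CmonEdge m v v
  noLoop _ v (inj₁ eq) = 1+n≢n eq
  noLoop (s≤s (s≤s _)) v (inj₂ (v≡0 , 1+v≡m))
    with () ← trans (sym v≡0) (ℕ.suc-injective 1+v≡m)

data Colour : Set where
  colour₁ colour₂ : Colour

-- The values on the diagonal are irrelevant: embeddings are injective and
-- graphs are loopless, so only colours of pairs of distinct vertices are used.
record EdgeColouring (n : ℕ) : Set where
  field
    colour      : Fin n → Fin n → Colour
    colour-symm : ∀ u v → colour u v ≡ colour v u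

open EdgeColouring public using (colour)

record IsEmbedding {h n} (H : Graph h) (χ : EdgeColouring n) (j : Colour)
                   (φ : Fin h → Fin n) : Set where
  field
    injective  : Injective _≡_ _≡_ φ
    monochrome : ∀ {u v} → Adj H u v → colour χ (φ u) (φ v) ≡ j

-- (φ(t), …, φ(h-1), φ(0), …, φ(t-1))
rotated : ∀ {h n} → (Fin h → Fin n) → Fin h → List (Fin n)
rotated φ t = drop (toℕ t) (tabulate φ) ++ take (toℕ t) (tabulate φ)

CyclicallyIncreasing : ∀ {h n} → (Fin h → Fin n) → Set
CyclicallyIncreasing φ = ∃[ t ] Linked _<_ (rotated φ t)

HasCyclicEmbedding : ∀ {h n} → Graph h → EdgeColouring n → Colour → Set
HasCyclicEmbedding H χ j = ∃[ φ ] IsEmbedding H χ j φ × CyclicallyIncreasing φ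

CyclicArrows : ∀ {h₁ h₂} → Graph h₁ → Graph h₂ → ℕ → Set
CyclicArrows H₁ H₂ n = (χ : EdgeColouring n) →
  HasCyclicEmbedding H₁ χ colour₁ ⊎ HasCyclicEmbedding H₂ χ colour₂

-- R_cyc(H₁, H₂) = r, as the graph of the partial function "smallest n such that …".
IsRcyc : ∀ {h₁ h₂} → Graph h₁ → Graph h₂ → ℕ → Set
IsRcyc H₁ H₂ r = CyclicArrows H₁ H₂ r × (∀ n → CyclicArrows H₁ H₂ n → r ≤ n)

{-# OPTIONS --safe #-}
-- Cut the r ≤ (a-1)(b-1) vertices into at most b-1 consecutive intervals of
-- length at most a-1.  Colour an edge 1 inside an interval and 2 between two
-- intervals.  A connected graph in colour 1 stays inside one interval, which
-- has fewer than a vertices.  The closing edge of a monotone cycle makes it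
-- invariant under rotation, so the sorted vertices of a cyclically increasing
-- copy in colour 2 lie in strictly increasing intervals, of which there are
-- fewer than b.
module Submission where

open import Defs
open import Data.Nat.Base using (ℕ; _≤_; _≥_; _+_; _*_; _∸_)

open import Data.Nat.Base using (zero; suc; _<_; NonZero; _/_; s≤s; z≤n)
import Data.Nat.Properties as ℕ
open import Data.Nat.DivMod using (m≡m%n+[m/n]*n; _mod_; m%n<n; /-monoˡ-≤; m<n*o⇒m/o<n)
open import Data.Fin.Base using (Fin; zero; suc; toℕ; fromℕ)
open import Data.Fin.Properties using (toℕ<n; toℕ-fromℕ; toℕ-fromℕ<; toℕ-injective; injective⇒≤)
open import Data.List.Base using ([]; _∷_; _++_; length; last; head; drop; take; tabulate)
open import Data.List.Properties using (length-++-comm; take++drop≡id; length-tabulate)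
open import Data.List.Relation.Unary.Linked using (Linked; []; [-]; _∷_; tail; zipWith)
open import Data.List.Relation.Unary.Linked.Properties using (++⁺)
open import Data.Maybe.Base using (just)
open import Data.Maybe.Relation.Binary.Connected using (just; just-nothing)
import Data.Maybe.Relation.Binary.Connected as Maybe
open import Data.Product.Base using (_,_)
open import Data.Sum.Base using (inj₁; inj₂; [_,_])
open import Function.Base using (_∘_)
open import Relation.Binary.Construct.Closure.ReflexiveTransitive using (fold)
open import Relation.Binary.Core using (Rel)
open import Relation.Binary.PropositionalEquality
  using (_≡_; _≢_; refl; sym; trans; cong; cong₂; subst; module ≡-Reasoning)
open import Relation.Nullary.Decidable using (yes; no)
open import Relation.Nullary.Negation using (¬_; contradiction)

-- Since `toℕ t` is at most `n`, the drop never reaches the final one of the `suc n` entries.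
last-drop-tabulate : ∀ {a} {A : Set a} {n} (f : Fin (suc n) → A) (t : Fin (suc n)) →
                     last (drop (toℕ t) (tabulate f)) ≡ just (f (fromℕ n))
last-drop-tabulate {n = zero}  f zero    = refl
last-drop-tabulate {n = suc n} f zero    = last-drop-tabulate (f ∘ suc) zero
last-drop-tabulate {n = suc n} f (suc t) = last-drop-tabulate (f ∘ suc) t

module _ {a ℓ} {A : Set a} {R : Rel A ℓ} where

  drop⁺ : ∀ n {xs} → Linked R xs → Linked R (drop n xs)
  drop⁺ zero            Rxs = Rxs
  drop⁺ (suc n) {[]}    _   = []
  drop⁺ (suc n) {_ ∷ _} Rxs = drop⁺ n (tail Rxs)

  take⁺ : ∀ n {xs} → Linked R xs → Linked R (take n xs)
  take⁺ zero          _           = []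
  take⁺ (suc n)       []          = []
  take⁺ (suc zero)    [-]         = [-]
  take⁺ (suc (suc n)) [-]         = [-]
  take⁺ (suc zero)    (_ ∷ _)     = [-]
  take⁺ (suc (suc n)) (Rxy ∷ Rxs) = Rxy ∷ take⁺ (suc n) Rxs

  tabulate⁺ : ∀ {n} (f : Fin n → A) →
              (∀ i j → suc (toℕ i) ≡ toℕ j → R (f i) (f j)) →
              Linked R (tabulate f)
  tabulate⁺ {zero}        f Rf = []
  tabulate⁺ {suc zero}    f Rf = [-]
  tabulate⁺ {suc (suc n)} f Rf =
    Rf zero (suc zero) refl ∷ tabulate⁺ (f ∘ suc) (λ i j → Rf (suc i) (suc j) ∘ cong suc)

  -- Rotating creates at most one new neighbouring pair, the original last entry followed by the
  -- original first; `closing` covers it.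
  linked-rotation : ∀ {n} (f : Fin (suc n) → A) →
                    (∀ i j → suc (toℕ i) ≡ toℕ j → R (f i) (f j)) →
                    R (f (fromℕ n)) (f zero) → ∀ (t : Fin (suc n)) →
                    Linked R (drop (toℕ t) (tabulate f) ++ take (toℕ t) (tabulate f))
  linked-rotation f Rf closing t =
    ++⁺ (drop⁺ (toℕ t) Rtab) join (take⁺ (toℕ t) Rtab)
    where
    Rtab = tabulate⁺ f Rf

    join-just : ∀ m → Maybe.Connected R (just (f (fromℕ _))) (head (take m (tabulate f)))
    -- For `t` zero nothing wraps around, so the junction is vacuous.
    join-just zero    = just-nothing
    join-just (suc m) = just closing

    join : Maybe.Connected R (last (drop (toℕ t) (tabulate f))) (head (take (toℕ t) (tabulate f)))
    join rewrite last-drop-tabulate f t = join-just (toℕ t)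

length-rotated : ∀ {h n} (φ : Fin h → Fin n) t → length (rotated φ t) ≡ h
length-rotated {h} φ t = begin
  length (drop m xs ++ take m xs)  ≡⟨ length-++-comm (drop m xs) (take m xs) ⟩
  length (take m xs ++ drop m xs)  ≡⟨ cong length (take++drop≡id m xs) ⟩
  length xs                        ≡⟨ length-tabulate φ ⟩
  h                                ∎
  where
  open ≡-Reasoning
  m  = toℕ t
  xs = tabulate φ

module _ {a} {A : Set a} (f : A → ℕ) {m} (f< : ∀ x → f x < m) where

  -- Each step raises `f` by at least one, so the last value is at least `f x + length xs`, yet
  -- below `m`. Keeping `f x` in the bound lets the induction pass to the tail.
  head+length≤bound : ∀ x {xs} → Linked (λ y z → f y < f z) (x ∷ xs) →
                      f x + length (x ∷ xs) ≤ m
  head+length≤bound x [-] rewrite ℕ.+-comm (f x) 1 = f< x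
  head+length≤bound x {y ∷ xs} (fx<fy ∷ fxs) rewrite ℕ.+-suc (f x) (length (y ∷ xs)) =
    ℕ.≤-trans (ℕ.+-monoˡ-≤ (length (y ∷ xs)) fx<fy) (head+length≤bound y fxs)

  length≤bound : ∀ {xs} → Linked (λ y z → f y < f z) xs → length xs ≤ m
  length≤bound {[]}     _   = z≤n
  length≤bound {x ∷ xs} fxs = ℕ.m+n≤o⇒n≤o (f x) (head+length≤bound x fxs)

module IntervalColouring (r d : ℕ) .{{_ : NonZero d}} where

  block : Fin r → ℕ
  block v = toℕ v / d

  sameColour : ℕ → ℕ → Colour
  sameColour p q with p ℕ.≟ q
  ... | yes _ = colour₁
  ... | no  _ = colour₂

  sameColour-comm : ∀ p q → sameColour p q ≡ sameColour q p
  sameColour-comm p q with p ℕ.≟ q | q ℕ.≟ p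
  ... | yes _   | yes _   = refl
  ... | no  _   | no  _   = refl
  ... | yes p≡q | no  q≢p = contradiction (sym p≡q) q≢p
  ... | no  p≢q | yes q≡p = contradiction (sym q≡p) p≢q

  colour₁⇒≡ : ∀ p q → sameColour p q ≡ colour₁ → p ≡ q
  colour₁⇒≡ p q eq with yes p≡q ← p ℕ.≟ q = p≡q

  colour₂⇒≢ : ∀ p q → sameColour p q ≡ colour₂ → p ≢ q
  colour₂⇒≢ p q eq with no p≢q ← p ℕ.≟ q = p≢q

  χ : EdgeColouring r
  χ = record
    { colour      = λ u v → sameColour (block u) (block v)
    ; colour-symm = λ u v → sameColour-comm (block u) (block v)
    }

  block-mod-injective : ∀ u v → block u ≡ block v → toℕ u mod d ≡ toℕ v mod d → u ≡ v
  block-mod-injective u v block≡ mod≡ = toℕ-injective (begin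
    toℕ u                                ≡⟨ decompose u ⟩
    toℕ (toℕ u mod d) + block u * d      ≡⟨ cong₂ (λ x y → toℕ x + y * d) mod≡ block≡ ⟩
    toℕ (toℕ v mod d) + block v * d      ≡⟨ decompose v ⟨
    toℕ v                                ∎)
    where
    open ≡-Reasoning
    decompose : ∀ w → toℕ w ≡ toℕ (toℕ w mod d) + block w * d
    decompose w = trans (m≡m%n+[m/n]*n (toℕ w) d)
                        (cong (_+ block w * d) (sym (toℕ-fromℕ< (m%n<n (toℕ w) d))))

  -- Every edge in colour 1 preserves the block, hence so does every path. Within one block the
  -- remainder modulo `d` separates vertices, which injects `Fin a` into `Fin d`.
  connected-order≤ : ∀ {a} {H : Graph a} → Connected H →
                     HasCyclicEmbedding H χ colour₁ → a ≤ d
  connected-order≤ {H = H} conn (φ , emb , _) = injective⇒≤ {f = λ v → toℕ (φ v) mod d}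
    λ {u} {v} mod≡ → injective (block-mod-injective (φ u) (φ v) (block-const u v) mod≡)
    where
    open IsEmbedding emb
    block-const : ∀ u v → block (φ u) ≡ block (φ v)
    block-const u v = fold (λ u v → block (φ u) ≡ block (φ v))
      (λ adj → trans (colour₁⇒≡ _ _ (monochrome adj))) refl (conn u v)

  -- Along the rotated list the vertex order gives weakly increasing blocks, and colour 2 makes
  -- neighbouring blocks distinct.
  Cmon-order≤ : ∀ {b m} (2≤b : 2 ≤ b) → r ≤ m * d →
                HasCyclicEmbedding (Cmon b 2≤b) χ colour₂ → b ≤ m
  Cmon-order≤ {suc n} {m} 2≤b r≤m*d (φ , emb , t , increasing) =
    subst (_≤ m) (length-rotated φ t)
      (length≤bound block block<m (zipWith block-increases (increasing , blocks-differ)))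
    where
    open IsEmbedding emb

    block<m : ∀ v → block v < m
    block<m v = m<n*o⇒m/o<n (ℕ.<-≤-trans (toℕ<n v) r≤m*d)

    blocks-differ : Linked (λ u v → block u ≢ block v) (rotated φ t)
    blocks-differ = linked-rotation φ
      (λ i j 1+i≡j → colour₂⇒≢ _ _ (monochrome (inj₁ (inj₁ 1+i≡j))))
      -- `CmonEdge` directs the closing edge from the first vertex to the last; the wrap-around runs
      -- the other way, hence the outer `inj₂`.
      (colour₂⇒≢ _ _ (monochrome (inj₂ (inj₂ (refl , cong suc (toℕ-fromℕ n))))))
      t

    block-increases : ∀ {u v} → _ → block u < block v
    block-increases (u<v , block≢) = ℕ.≤∧≢⇒< (/-monoˡ-≤ d (ℕ.<⇒≤ u<v)) block≢

¬CyclicArrows-0 : ∀ {a b} (H : Graph a) (G : Graph (suc b)) → ¬ CyclicArrows H G 0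
¬CyclicArrows-0 H G arrows
  with arrows record { colour = λ () ; colour-symm = λ () }
-- The rotation index `t` is itself a vertex of `H`, so this also rules out an `H` of order 0.
... | inj₁ (φ , _ , t , _) with () ← φ t
... | inj₂ (φ , _)         with () ← φ zero

-- Intervals of length `d` require `d` nonzero; for `d` zero the bound forces `r` to be 0. Otherwise
-- an embedding would give `suc d ≤ d` or `suc m ≤ m`.
¬CyclicArrows-small : ∀ {d b r} (H : Graph (suc d)) → Connected H → (2≤b : 2 ≤ b) →
                      r ≤ d * (b ∸ 1) → ¬ CyclicArrows H (Cmon b 2≤b) r
¬CyclicArrows-small {zero}      {suc m} {zero} H _ 2≤b _ = ¬CyclicArrows-0 H (Cmon _ 2≤b)
¬CyclicArrows-small {d@(suc _)} {suc m} {r} H conn 2≤b r≤d*m arrows =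
  [ ℕ.1+n≰n ∘ connected-order≤ {H = H} conn
  , ℕ.1+n≰n ∘ Cmon-order≤ 2≤b (subst (r ≤_) (ℕ.*-comm d m) r≤d*m)
  ] (arrows χ)
  where open IntervalColouring r d

theorem4p6 : (a : ℕ) (H : Graph a) → Connected H →
    (b : ℕ) (2≤b : 2 ≤ b) →
    (r : ℕ) → IsRcyc H (Cmon b 2≤b) r →
    r ≥ 1 + (a ∸ 1) * (b ∸ 1)
-- With truncated subtraction the bound for order 0 is 1, so only `r` = 0 has to be excluded.
theorem4p6 zero    H conn (suc m) 2≤b zero    (arrows , _) =
  contradiction arrows (¬CyclicArrows-0 H (Cmon _ 2≤b))
theorem4p6 zero    H conn b       2≤b (suc r) _            = s≤s z≤n
theorem4p6 (suc d) H conn b       2≤b r       (arrows , _) =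
  ℕ.≰⇒> λ r≤ → ¬CyclicArrows-small H conn 2≤b r≤ arrows
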